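{- Let $N=pq$ where $p<q$ are primes. Let $f\in\mathbb{Z}[X]$ and $d:=\deg f$. Let $n$ be the number of distinct zeros of $f$ modulo $p$ and $m$ the number of distinct zeros of $f$ modulo $q$. Then: (1) $\nu(f)=mp+nq-2nm$. (2) If $f\neq 0$ in $\mathbb{Z}_p[X]$ and in $\mathbb{Z}_q[X]$, and $d<p/2$, then $\nu(f)\leq dp+dq-2d^2$.
   Context: $Z_N=\{0,1,\dots,N-1\}$ and $\mathbb{Z}_n=\mathbb{Z}/n\mathbb{Z}$. For $g\in\mathbb{Z}[X]$, an element $x\in Z_N$ is called suitable for $g$ if $1<\gcd(g(x),N)<N$, and $\nu(g)$ denotes the number of $x\in Z_N$ suitable for $g$. -}

module Defs where

open import Data.Integer using (ℤ; +_; 0ℤ; 1ℤ; _+_; _*_; _<_; ∣_∣)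
open import Data.Integer.Divisibility using (_∣_)
open import Data.Integer.GCD using (gcd)
import Data.Integer.Properties as ℤ
open import Data.List using (List; []; _∷_; length; filter; foldr; upTo)
open import Data.List.Relation.Unary.All using (All; all?)
open import Data.Nat using (ℕ; zero; suc)
import Data.Nat.Divisibility as ℕ
open import Data.Product using (_×_)
open import Relation.Nullary using (Dec; yes; no)
open import Relation.Nullary.Decidable using (_×-dec_)

-- The list c₀ ∷ c₁ ∷ … ∷ c_k ∷ [] stands for c₀ + c₁ X + … + c_k X^k.
-- Trailing zero coefficients are allowed, so a polynomial has several
-- representatives; no notion below depends on the choice.
ℤ[X] : Set
ℤ[X] = List ℤ

eval : ℤ[X] → ℤ → ℤ
eval f x = foldr (λ c r → c + x * r) 0ℤ f

-- The largest exponent with a nonzero coefficient, ignoring trailing zeros.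
-- Junk value: deg f = 0 when f is the zero polynomial.
deg : ℤ[X] → ℕ
deg []      = zero
deg (c ∷ f) with all? (ℤ._≟ 0ℤ) f
... | yes _ = zero
... | no  _ = suc (deg f)

-- The image of f in (ℤ/nℤ)[X] is the zero polynomial (not merely the zero
-- function on ℤ/nℤ).
ZeroMod : ℕ → ℤ[X] → Set
ZeroMod n f = All (λ c → + n ∣ c) f

IsRootMod : ℕ → ℤ[X] → ℕ → Set
IsRootMod n f x = + n ∣ eval f (+ x)

isRootMod? : ∀ n f x → Dec (IsRootMod n f x)
isRootMod? n f x = n ℕ.∣? ∣ eval f (+ x) ∣

-- Each class of ℤ/nℤ has exactly one representative in upTo n (0, …, n - 1).
#zerosMod : ℕ → ℤ[X] → ℕ
#zerosMod n f = length (filter (isRootMod? n f) (upTo n))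

Suitable : ℕ → ℤ[X] → ℕ → Set
Suitable N g x = 1ℤ < gcd (eval g (+ x)) (+ N) × gcd (eval g (+ x)) (+ N) < + N

suitable? : ∀ N g x → Dec (Suitable N g x)
suitable? N g x = (1ℤ ℤ.<? gcd (eval g (+ x)) (+ N)) ×-dec (gcd (eval g (+ x)) (+ N) ℤ.<? + N)

ν : ℕ → ℤ[X] → ℕ
ν N g = length (filter (suitable? N g) (upTo N))

{-# OPTIONS --safe #-}

-- (1) Since p and q are distinct primes, 1 < gcd(f(x), pq) < pq holds iff
-- exactly one of p, q divides f(x).  By the Chinese remainder theorem
-- x ↦ (x mod p, x mod q) therefore carries the suitable x onto the pairs with
-- exactly one component a zero, of which there are n(q - m) + (p - n)m.
--
-- (2) By Lagrange's bound n, m ≤ d.  With a = d - n and b = d - m, the claimed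
-- bound exceeds the value from (1) by b(p - 2d) + a(q - 2d) + 2ab ≥ 0.

module Submission where

open import Defs
open import Data.Integer using (ℤ; +_; _+_; _-_; _*_; _≤_; -_; ∣_∣; 0ℤ; +<+)
open import Data.Integer.Divisibility.Signed as ℤ
  using (divides; ∣ᵤ⇒∣; ∣⇒∣ᵤ; ∣m⇒∣-m; ∣m∣n⇒∣m+n; ∣m+n∣m⇒∣n; ∣m⇒∣m*n; ∣n⇒∣m*n)
  renaming (_∣_ to _∣ₛ_)
open import Data.Integer.DivMod using (_%ℕ_; _/ℕ_; n%ℕd<d; a≡a%ℕn+[a/ℕn]*n)
import Data.Integer.Properties as ℤ
open import Data.Integer.Tactic.RingSolver using (solve-∀)
open import Data.List using (List; []; _∷_; length; filter; map; upTo; cartesianProduct)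
open import Data.List.Membership.Propositional using (_∈_)
open import Data.List.Membership.Propositional.Properties
  using (∈-map⁺; ∈-map⁻; ∈-filter⁺; ∈-filter⁻; ∈-upTo⁺; ∈-upTo⁻;
         ∈-cartesianProduct⁺; ∈-cartesianProduct⁻)
open import Data.List.Membership.Propositional.Properties.WithK using (unique∧set⇒bag)
open import Data.List.Properties
  using (length-map; length-++; length-upTo; filter-≐)
open import Data.List.Relation.Binary.BagAndSetEquality using (∼bag⇒↭)
open import Data.List.Relation.Binary.Permutation.Propositional.Properties using (↭-length)
open import Data.List.Relation.Unary.All as All using (All; []; _∷_; all?)
import Data.List.Relation.Unary.All.Properties as All
open import Data.List.Relation.Unary.AllPairs using ([]; _∷_)
open import Data.List.Relation.Unary.Any using (here; there)
open import Data.List.Relation.Unary.Unique.Propositional using (Unique)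
import Data.List.Relation.Unary.Unique.Propositional.Properties as Unique
open import Data.Nat as ℕ using (ℕ; NonZero; z≤n; s≤s)
open import Data.Nat.Coprimality as Coprime using (Coprime; coprime-Bézout; coprime-divisor; coprime⇒gcd≡1)
open import Data.Nat.Divisibility as ℕ using (_∣_)
open import Data.Nat.GCD as ℕ using (module Bézout)
open import Data.Nat.Primality
  using (Prime; euclidsLemma; prime⇒irreducible; prime⇒nonZero; prime⇒nonTrivial)
open import Data.Nat.DivMod using (m%n<n)
import Data.Nat.Properties as ℕ
open import Data.Product using (_×_; _,_; proj₁; ∃₂; ∃-syntax)
open import Data.Product.Properties using (,-injectiveˡ; ,-injectiveʳ)
open import Data.Sum using (inj₁; inj₂; [_,_]′)
open import Data.Empty using (⊥)
open import Level using (Level)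
open import Function using (_∘_; id; mk⇔)
open import Relation.Binary using (_Respects_)
open import Relation.Binary.PropositionalEquality
  using (_≡_; _≢_; refl; sym; trans; cong; cong₂; subst; module ≡-Reasoning)
open import Relation.Nullary using (¬_; yes; no; contradiction)
open import Relation.Unary using (Pred; Decidable; ∁; _∩_; _∪_; _≐_)
open import Relation.Unary.Properties using (∁?; _∩?_; _∪?_)

private
  variable
    ℓ ℓ′ : Level
    A B : Set
    P : Pred ℕ ℓ
    Q : Pred ℕ ℓ′

-- Congruence and the Chinese remainder theorem

-- A record, not a function into divisibility, so that `x` and `y` can be inferred from the type:
-- unification could not recover them from `+ x - + y`.
record Congruent (n x y : ℕ) : Set where
  constructor congruent
  field ∣-difference : + n ∣ₛ + x - + y

open Congruent

congruent-sym : ∀ {n x y} → Congruent n x y → Congruent n y x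
congruent-sym {n} {x} {y} (congruent n∣x-y) =
  congruent (subst (+ n ∣ₛ_) (lemma (+ x) (+ y)) (∣m⇒∣-m n∣x-y))
  where
  lemma : ∀ x y → - (x - y) ≡ y - x
  lemma = solve-∀

congruent-trans : ∀ {n x y z} → Congruent n x y → Congruent n y z → Congruent n x z
congruent-trans {n} {x} {y} {z} (congruent n∣x-y) (congruent n∣y-z) =
  congruent (subst (+ n ∣ₛ_) (lemma (+ x) (+ y) (+ z)) (∣m∣n⇒∣m+n n∣x-y n∣y-z))
  where
  lemma : ∀ x y z → x - y + (y - z) ≡ x - z
  lemma = solve-∀

congruent-% : ∀ x n .{{_ : NonZero n}} → Congruent n x (x ℕ.% n)
congruent-% x n = congruent (divides (+ x /ℕ n) (begin
  + x - r                      ≡⟨ cong (_- r) (a≡a%ℕn+[a/ℕn]*n (+ x) n) ⟩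
  r + (+ x /ℕ n) * + n - r     ≡⟨ lemma r ((+ x /ℕ n) * + n) ⟩
  (+ x /ℕ n) * + n             ∎))
  where
  open ≡-Reasoning
  r = + (x ℕ.% n)
  lemma : ∀ r s → r + s - r ≡ s
  lemma = solve-∀

%-≡⇒congruent : ∀ n .{{_ : NonZero n}} {x y} → x ℕ.% n ≡ y ℕ.% n → Congruent n x y
%-≡⇒congruent n {x} {y} eq = congruent-trans (congruent-% x n)
  (subst (λ r → Congruent n r y) (sym eq) (congruent-sym (congruent-% y n)))

-- The distance between `x` and `y` is at most their maximum, hence below `n`, and 0 is the only
-- multiple of `n` there.
congruent-<⇒≡ : ∀ {n x y} → x ℕ.< n → y ℕ.< n → Congruent n x y → x ≡ y
congruent-<⇒≡ {n} {x} {y} x<n y<n (congruent n∣x-y) =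
  ℤ.+-injective (ℤ.i-j≡0⇒i≡j (+ x) (+ y) (ℤ.∣i∣≡0⇒i≡0 (∣∧<⇒≡0 (∣⇒∣ᵤ n∣x-y) ∣x-y∣<n)))
  where
  ∣∧<⇒≡0 : ∀ {k} → n ∣ k → k ℕ.< n → k ≡ 0
  ∣∧<⇒≡0 {ℕ.zero}  _   _   = refl
  ∣∧<⇒≡0 {ℕ.suc _} n∣k k<n = contradiction (ℕ.∣⇒≤ n∣k) (ℕ.<⇒≱ k<n)
  ∣x-y∣<n : ∣ + x - + y ∣ ℕ.< n
  ∣x-y∣<n rewrite ℤ.m-n≡m⊖n x y = ℕ.≤-<-trans (ℤ.∣m⊝n∣≤m⊔n x y) (ℕ.⊔-pres-<m x<n y<n)

congruent-<⇒%≡ : ∀ {n x y} .{{_ : NonZero n}} → y ℕ.< n → Congruent n x y → x ℕ.% n ≡ y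
congruent-<⇒%≡ {n} {x} y<n x≡y =
  congruent-<⇒≡ (m%n<n x n) y<n (congruent-trans (congruent-sym (congruent-% x n)) x≡y)

-- Write `k` as `j * p`. As `q` is coprime to `p` and divides this product, it divides `j`.
coprime-*-∣ : ∀ {p q k} → Coprime p q → p ∣ k → q ∣ k → p ℕ.* q ∣ k
coprime-*-∣ {p} {q} p⊥q (ℕ.divides-refl j) q∣jp =
  subst (_∣ j ℕ.* p) (ℕ.*-comm q p) (ℕ.*-monoˡ-∣ p
    (coprime-divisor (Coprime.sym p⊥q) (subst (q ∣_) (ℕ.*-comm j p) q∣jp)))

-- Over the naturals the negative Bézout term stands on the other side of the equation; moving it
-- across in this form serves both sign cases below.
bézout-ℤ : ∀ {p q} x y → 1 ℕ.+ y ℕ.* q ≡ x ℕ.* p → + x * + p + - + y * + q ≡ + 1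
bézout-ℤ {p} {q} x y eq = begin
  + x * + p + - + y * + q              ≡⟨ cong (_+ - + y * + q) (ℤ.pos-* x p) ⟨
  + (x ℕ.* p) + - + y * + q            ≡⟨ cong (λ t → + t + - + y * + q) eq ⟨
  + 1 + + (y ℕ.* q) + - + y * + q      ≡⟨ cong (λ t → + 1 + t + - + y * + q) (ℤ.pos-* y q) ⟩
  + 1 + + y * + q + - + y * + q        ≡⟨ lemma (+ y) (+ q) ⟩
  + 1                                  ∎
  where
  open ≡-Reasoning
  lemma : ∀ y q → + 1 + y * q + - y * q ≡ + 1
  lemma = solve-∀

coprime-Bézout-ℤ : ∀ {p q} → Coprime p q → ∃₂ λ u v → u * + p + v * + q ≡ + 1
coprime-Bézout-ℤ {p} {q} p⊥q with coprime-Bézout p⊥q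
... | Bézout.+- x y eq = + x , - + y , bézout-ℤ x y eq
... | Bézout.-+ x y eq = - + x , + y , trans (ℤ.+-comm (- + x * + p) (+ y * + q)) (bézout-ℤ y x eq)

chineseRemainder : ∀ {p q} .{{_ : NonZero (p ℕ.* q)}} → Coprime p q → ∀ a b →
                   ∃[ x ] x ℕ.< p ℕ.* q × Congruent p x a × Congruent q x b
chineseRemainder {p} {q} p⊥q a b with coprime-Bézout-ℤ p⊥q
... | u , v , up+vq≡1 = z %ℕ N , n%ℕd<d z N , congruent p∣r-a , congruent q∣r-b
  where
  N = p ℕ.* q
  -- Modulo `p` this is plainly `a`. Modulo `q` the Bézout identity makes `p * u` equal to 1, which
  -- leaves `b`.
  z = + a + + p * u * (+ b - + a)
  k = z /ℕ N
  r = + (z %ℕ N)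

  r≡ : r ≡ z - k * (+ p * + q)
  r≡ = begin
    r                              ≡⟨ cancel r (k * (+ p * + q)) ⟩
    r + k * (+ p * + q) - k * (+ p * + q)
      ≡⟨ cong (λ t → r + k * t - k * (+ p * + q)) (sym (ℤ.pos-* p q)) ⟩
    r + k * + N - k * (+ p * + q)  ≡⟨ cong (_- k * (+ p * + q)) (sym (a≡a%ℕn+[a/ℕn]*n z N)) ⟩
    z - k * (+ p * + q)            ∎
    where
    open ≡-Reasoning
    cancel : ∀ s t → s ≡ s + t - t
    cancel = solve-∀

  p∣r-a : + p ∣ₛ r - + a
  p∣r-a = divides (u * (+ b - + a) - k * + q)
    (trans (cong (_- + a) r≡) (lemma (+ a) (+ b) (+ p) (+ q) u k))
    where
    lemma : ∀ a b p q u k → a + p * u * (b - a) - k * (p * q) - a ≡ (u * (b - a) - k * q) * p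
    lemma = solve-∀

  q∣r-b : + q ∣ₛ r - + b
  q∣r-b = divides (v * (+ a - + b) - k * + p) (begin
    r - + b
      ≡⟨ cong (_- + b) r≡ ⟩
    + a + + p * u * (+ b - + a) - k * (+ p * + q) - + b
      -- The coefficient 1 is made explicit so that the Bézout identity can replace it; the `p * u`
      -- terms then cancel and a multiple of `q` remains.
      ≡⟨ lemma₁ (+ a) (+ b) (+ p) (+ q) u k ⟩
    + 1 * (+ a - + b) - + p * u * (+ a - + b) - k * (+ p * + q)
      ≡⟨ cong (λ t → t * (+ a - + b) - + p * u * (+ a - + b) - k * (+ p * + q)) (sym up+vq≡1) ⟩
    (u * + p + v * + q) * (+ a - + b) - + p * u * (+ a - + b) - k * (+ p * + q)
      ≡⟨ lemma₂ (+ a) (+ b) (+ p) (+ q) u v k ⟩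
    (v * (+ a - + b) - k * + p) * + q
      ∎)
    where
    open ≡-Reasoning
    lemma₁ : ∀ a b p q u k → a + p * u * (b - a) - k * (p * q) - b ≡
                             + 1 * (a - b) - p * u * (a - b) - k * (p * q)
    lemma₁ = solve-∀
    lemma₂ : ∀ a b p q u v k → (u * p + v * q) * (a - b) - p * u * (a - b) - k * (p * q) ≡
                               (v * (a - b) - k * p) * q
    lemma₂ = solve-∀

-- Counting

length-cartesianProduct : ∀ (xs : List A) (ys : List B) →
                          length (cartesianProduct xs ys) ≡ length xs ℕ.* length ys
length-cartesianProduct []       ys = refl
length-cartesianProduct (x ∷ xs) ys = trans (length-++ (map (x ,_) ys))
  (cong₂ ℕ._+_ (length-map (x ,_) ys) (length-cartesianProduct xs ys))

-- Injectivity is asked only on members of `xs`, because a number is determined by its residues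
-- modulo `p` and `q` only below `p * q`.
unique-map⁺ : ∀ {f : A → B} {xs} → (∀ {x y} → x ∈ xs → y ∈ xs → f x ≡ f y → x ≡ y) →
              Unique xs → Unique (map f xs)
unique-map⁺ inj []         = []
unique-map⁺ inj (x∉ ∷ xs!) =
  All.map⁺ (All.tabulate λ y∈ eq → All.lookup x∉ y∈ (inj (here refl) (there y∈) eq)) ∷
  unique-map⁺ (λ x∈ y∈ → inj (there x∈) (there y∈)) xs!

length-filter-∪ : {P : Pred A ℓ} {Q : Pred A ℓ′} (P? : Decidable P) (Q? : Decidable Q) →
                  (∀ {x} → P x → Q x → ⊥) → ∀ xs →
                  length (filter (P? ∪? Q?) xs) ≡ length (filter P? xs) ℕ.+ length (filter Q? xs)
length-filter-∪ P? Q? disj []       = refl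
length-filter-∪ P? Q? disj (x ∷ xs) with ih ← length-filter-∪ P? Q? disj xs | P? x | Q? x
... | yes px | yes qx = contradiction qx (disj px)
... | yes _  | no _   = cong ℕ.suc ih
... | no _   | yes _  = trans (cong ℕ.suc ih) (sym (ℕ.+-suc _ _))
... | no _   | no _   = ih

length-filter-∁ : {P : Pred A ℓ} (P? : Decidable P) → ∀ xs →
                  length (filter P? xs) ℕ.+ length (filter (∁? P?) xs) ≡ length xs
length-filter-∁ P? []       = refl
length-filter-∁ P? (x ∷ xs) with ih ← length-filter-∁ P? xs | P? x
... | yes _ = cong ℕ.suc ih
... | no _  = trans (ℕ.+-suc _ _) (cong ℕ.suc ih)

count : Decidable P → ℕ → ℕ
count P? n = length (filter P? (upTo n))

count-∁ : (P? : Decidable P) → ∀ n → count P? n ℕ.+ count (∁? P?) n ≡ n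
count-∁ P? n = trans (length-filter-∁ P? (upTo n)) (length-upTo n)

-- The Chinese remainder theorem as a count: taking residues carries the list on the left onto the
-- cartesian product of the two on the right. Both are free of duplicates and have the same members,
-- so one is a permutation of the other.
count-∩ : ∀ {p q} .{{_ : NonZero p}} .{{_ : NonZero q}} → Coprime p q →
          (P? : Decidable P) (Q? : Decidable Q) →
          P Respects Congruent p → Q Respects Congruent q →
          count (P? ∩? Q?) (p ℕ.* q) ≡ count P? p ℕ.* count Q? q
count-∩ {p = p} {q = q} p⊥q P? Q? P-resp Q-resp = begin
  length xs                           ≡⟨ length-map residues xs ⟨
  length (map residues xs)            ≡⟨ ↭-length (∼bag⇒↭ (unique∧set⇒bag unique-residues unique-pairs (mk⇔ to from))) ⟩
  length (cartesianProduct ys zs)     ≡⟨ length-cartesianProduct ys zs ⟩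
  length ys ℕ.* length zs             ∎
  where
  open ≡-Reasoning
  instance
    pq≢0 : NonZero (p ℕ.* q)
    pq≢0 = ℕ.m*n≢0 p q
  xs = filter (P? ∩? Q?) (upTo (p ℕ.* q))
  ys = filter P? (upTo p)
  zs = filter Q? (upTo q)

  residues : ℕ → ℕ × ℕ
  residues x = x ℕ.% p , x ℕ.% q

  ∈xs⇒< : ∀ {x} → x ∈ xs → x ℕ.< p ℕ.* q
  ∈xs⇒< = ∈-upTo⁻ ∘ proj₁ ∘ ∈-filter⁻ (P? ∩? Q?) {xs = upTo (p ℕ.* q)}

  residues-injective : ∀ {x y} → x ∈ xs → y ∈ xs → residues x ≡ residues y → x ≡ y
  -- Equal residues make `p` and `q` divide the difference, so by coprimality `p * q` does too, and
  -- both numbers lie below `p * q`.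
  residues-injective {x} {y} x∈ y∈ eq = congruent-<⇒≡ (∈xs⇒< x∈) (∈xs⇒< y∈)
    (congruent (∣ᵤ⇒∣ (coprime-*-∣ p⊥q
      (∣⇒∣ᵤ (∣-difference (%-≡⇒congruent p {x} {y} (,-injectiveˡ eq))))
      (∣⇒∣ᵤ (∣-difference (%-≡⇒congruent q {x} {y} (,-injectiveʳ eq)))))))

  unique-residues : Unique (map residues xs)
  unique-residues = unique-map⁺ residues-injective (Unique.filter⁺ (P? ∩? Q?) (Unique.upTo⁺ (p ℕ.* q)))

  unique-pairs : Unique (cartesianProduct ys zs)
  unique-pairs = Unique.cartesianProduct⁺
    (Unique.filter⁺ P? (Unique.upTo⁺ p)) (Unique.filter⁺ Q? (Unique.upTo⁺ q))

  to : ∀ {ab} → ab ∈ map residues xs → ab ∈ cartesianProduct ys zs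
  to ab∈ with ∈-map⁻ residues ab∈
  ... | x , x∈xs , refl with ∈-filter⁻ (P? ∩? Q?) {xs = upTo (p ℕ.* q)} x∈xs
  ...   | _ , px , qx = ∈-cartesianProduct⁺
    (∈-filter⁺ P? (∈-upTo⁺ (m%n<n x p)) (P-resp (congruent-% x p) px))
    (∈-filter⁺ Q? (∈-upTo⁺ (m%n<n x q)) (Q-resp (congruent-% x q) qx))

  from : ∀ {ab} → ab ∈ cartesianProduct ys zs → ab ∈ map residues xs
  from {a , b} ab∈ =
    let a∈ys , b∈zs        = ∈-cartesianProduct⁻ ys zs ab∈
        a∈ , pa            = ∈-filter⁻ P? {xs = upTo p} a∈ys
        b∈ , qb            = ∈-filter⁻ Q? {xs = upTo q} b∈zs
        x , x< , x≡a , x≡b = chineseRemainder p⊥q a b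
    in subst (_∈ map residues xs)
      -- Since `a` is below `p` and `b` below `q`, the congruences force the residues of `x` to be
      -- exactly `a` and `b`.
      (cong₂ _,_ (congruent-<⇒%≡ (∈-upTo⁻ a∈) x≡a) (congruent-<⇒%≡ (∈-upTo⁻ b∈) x≡b))
      (∈-map⁺ residues (∈-filter⁺ (P? ∩? Q?) (∈-upTo⁺ x<)
        (P-resp (congruent-sym x≡a) pa , Q-resp (congruent-sym x≡b) qb)))

∁-respects : ∀ {n} → P Respects Congruent n → ∁ P Respects Congruent n
∁-respects P-resp c ¬px py = ¬px (P-resp (congruent-sym c) py)

-- Polynomials

suffixEvals : ℤ → ℤ[X] → ℤ[X]
suffixEvals x []      = []
suffixEvals x (c ∷ f) = eval (c ∷ f) x ∷ suffixEvals x f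

length-suffixEvals : ∀ x f → length (suffixEvals x f) ≡ length f
length-suffixEvals x []      = refl
length-suffixEvals x (c ∷ f) = cong ℕ.suc (length-suffixEvals x f)

-- Horner's scheme: suffixEvals x f is the quotient of c ∷ f by X - x.
eval-quotient : ∀ c f x y →
                eval (c ∷ f) y ≡ eval (c ∷ f) x + (y - x) * eval (suffixEvals x f) y
eval-quotient c []      x y = lemma c x y
  where
  lemma : ∀ c x y → c + y * 0ℤ ≡ c + x * 0ℤ + (y - x) * 0ℤ
  lemma = solve-∀
eval-quotient c (d ∷ f) x y =
  trans (cong (λ t → c + y * t) (eval-quotient d f x y))
        (lemma c x y (eval (d ∷ f) x) (eval (suffixEvals x f) y))
  where
  lemma : ∀ c x y e v → c + y * (e + (y - x) * v) ≡ c + x * e + (y - x) * (e + y * v)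
  lemma = solve-∀

-- By `eval-quotient` the values at `y` and at `x` differ by a multiple of `y - x`.
eval-respects : ∀ {n} f {x y} → + n ∣ₛ y - x → + n ∣ₛ eval f x → + n ∣ₛ eval f y
eval-respects []      _     n∣fx = n∣fx
eval-respects {n} (c ∷ f) {x} {y} n∣y-x n∣fx =
  subst (+ n ∣ₛ_) (sym (eval-quotient c f x y)) (∣m∣n⇒∣m+n n∣fx (∣m⇒∣m*n _ n∣y-x))

isRootMod-respects : ∀ n f → IsRootMod n f Respects Congruent n
isRootMod-respects n f {x} {y} x≡y root = ∣⇒∣ᵤ {+ n} {eval f (+ y)}
  (eval-respects {n} f {+ x} {+ y} (∣-difference (congruent-sym x≡y)) (∣ᵤ⇒∣ {+ n} {eval f (+ x)} root))

-- Coefficients are recovered from Horner's intermediate values: `c` is `eval (c ∷ f) x` minus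
-- `x * eval f x`, and `n` divides both.
zeroMod-suffixEvals⁻ : ∀ n x f → ZeroMod n (suffixEvals x f) → ZeroMod n f
zeroMod-suffixEvals⁻ n x []      []      = []
zeroMod-suffixEvals⁻ n x (c ∷ f) (h ∷ t) =
  ∣⇒∣ᵤ (ℤ.∣m+n∣n⇒∣m {+ n} {c} (∣ᵤ⇒∣ {+ n} {eval (c ∷ f) x} h) (∣n⇒∣m*n {+ n} x (∣eval f t))) ∷
  zeroMod-suffixEvals⁻ n x f t
  where
  ∣eval : ∀ f → ZeroMod n (suffixEvals x f) → + n ∣ₛ eval f x
  ∣eval []      []      = divides 0ℤ refl
  ∣eval (_ ∷ _) (h ∷ _) = ∣ᵤ⇒∣ h

-- Lagrange's bound, by induction: dividing out one root leaves a quotient with one coefficient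
-- fewer, and the remaining roots are roots of it. The length counts coefficients, so for nonempty
-- `f` the roots outnumber the formal degree.
manyRoots⇒zeroMod : ∀ {p} → Prime p → ∀ f xs → Unique xs → All (ℕ._< p) xs →
                    All (IsRootMod p f) xs → length f ℕ.≤ length xs → ZeroMod p f
manyRoots⇒zeroMod     pr []      xs       _          _            _              _         = []
manyRoots⇒zeroMod {p} pr (c ∷ f) (x ∷ xs) (x∉ ∷ xs!) (x<p ∷ xs<p) (root ∷ roots) (s≤s len) =
  -- The head of `suffixEvals` is the remainder, divisible by `p` because `x` is a root; its tail is
  -- the quotient, settled by induction.
  zeroMod-suffixEvals⁻ p (+ x) (c ∷ f) (root ∷
    manyRoots⇒zeroMod pr (suffixEvals (+ x) f) xs xs! xs<p
      (All.tabulate λ y∈ → quotient-root (All.lookup x∉ y∈) (All.lookup xs<p y∈) (All.lookup roots y∈))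
      (subst (ℕ._≤ length xs) (sym (length-suffixEvals (+ x) f)) len))
  where
  quotient-root : ∀ {y} → x ≢ y → y ℕ.< p → IsRootMod p (c ∷ f) y →
                  IsRootMod p (suffixEvals (+ x) f) y
  quotient-root {y} x≢y y<p rooty =
    -- Distinct numbers below `p` are incongruent, so Euclid's lemma leaves only the quotient as the
    -- factor divisible by `p`.
    [ (λ p∣y-x → contradiction (sym (congruent-<⇒≡ y<p x<p (congruent (∣ᵤ⇒∣ p∣y-x)))) x≢y) , id ]′
    (euclidsLemma _ _ pr (subst (p ∣_) (ℤ.abs-* (+ y - + x) _) (∣⇒∣ᵤ p∣prod)))
    where
    p∣prod : + p ∣ₛ (+ y - + x) * eval (suffixEvals (+ x) f) (+ y)
    p∣prod = ∣m+n∣m⇒∣n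
      (subst (+ p ∣ₛ_) (eval-quotient c f (+ x) (+ y)) (∣ᵤ⇒∣ {+ p} {eval (c ∷ f) (+ y)} rooty))
      (∣ᵤ⇒∣ {+ p} {eval (c ∷ f) (+ x)} root)

-- Trailing zeros can make the list longer than `suc (deg f)`, while `manyRoots⇒zeroMod` compares
-- lengths. The case split repeats that of `deg`, so the two recursions run in step.
trim : ℤ[X] → ℤ[X]
trim []      = []
trim (c ∷ f) with all? (ℤ._≟ 0ℤ) f
... | yes _ = c ∷ []
... | no  _ = c ∷ trim f

length-trim : ∀ f → length (trim f) ℕ.≤ ℕ.suc (deg f)
length-trim []      = z≤n
length-trim (c ∷ f) with all? (ℤ._≟ 0ℤ) f
... | yes _ = s≤s z≤n
... | no  _ = s≤s (length-trim f)

eval-zero : ∀ {f} x → All (_≡ 0ℤ) f → eval f x ≡ 0ℤ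
eval-zero x []         = refl
eval-zero x (refl ∷ z) rewrite eval-zero x z = trans (ℤ.+-identityˡ _) (ℤ.*-zeroʳ x)

eval-trim : ∀ f x → eval (trim f) x ≡ eval f x
eval-trim []      x = refl
eval-trim (c ∷ f) x with all? (ℤ._≟ 0ℤ) f
... | yes z = cong (λ t → c + x * t) (sym (eval-zero x z))
... | no  _ = cong (λ t → c + x * t) (eval-trim f x)

zeroMod-trim⁻ : ∀ n f → ZeroMod n (trim f) → ZeroMod n f
zeroMod-trim⁻ n []      []      = []
zeroMod-trim⁻ n (c ∷ f) z with all? (ℤ._≟ 0ℤ) f | z
... | yes f≡0 | h ∷ _ = h ∷ All.map (λ { refl → n ℕ.∣0 }) f≡0
... | no  _   | h ∷ t = h ∷ zeroMod-trim⁻ n f t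

-- More roots than `deg f` would force every coefficient to vanish modulo `p`. The degree is taken
-- over the integers; leading coefficients that vanish modulo `p` do no harm, since only the number
-- of coefficients is compared.
#zerosMod≤deg : ∀ {p} → Prime p → ∀ f → ¬ ZeroMod p f → #zerosMod p f ℕ.≤ deg f
#zerosMod≤deg {p} pr f f≢0 = ℕ.≮⇒≥ λ deg< → f≢0 (zeroMod-trim⁻ p f
  (manyRoots⇒zeroMod pr (trim f) roots
    (Unique.filter⁺ (isRootMod? p f) (Unique.upTo⁺ p))
    (All.filter⁺ (isRootMod? p f) (All.all-upTo p))
    (All.map (λ {x} → subst (λ e → p ∣ ∣ e ∣) (sym (eval-trim f (+ x))))
             (All.all-filter (isRootMod? p f) (upTo p)))
    -- `deg<` says `suc (deg f) ≤ length roots`, and `suc (deg f)` bounds the number of coefficients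
    -- of `trim f`.
    (ℕ.≤-trans (length-trim f) deg<)))
  where roots = filter (isRootMod? p f) (upTo p)

-- Suitability

distinctPrimes⇒coprime : ∀ {p q} → Prime p → Prime q → p ≢ q → Coprime p q
distinctPrimes⇒coprime pp pq p≢q (d∣p , d∣q) with prime⇒irreducible pp d∣p | prime⇒irreducible pq d∣q
... | inj₁ d≡1  | _         = d≡1
... | inj₂ _    | inj₁ d≡1  = d≡1
... | inj₂ refl | inj₂ refl = contradiction refl p≢q

prime∤⇒coprime : ∀ {p k} → Prime p → ¬ p ∣ k → Coprime k p
prime∤⇒coprime pp p∤k (d∣k , d∣p) with prime⇒irreducible pp d∣p
... | inj₁ d≡1  = d≡1
... | inj₂ refl = contradiction d∣k p∤k

-- A common divisor of `k` and `m * n` is coprime to `m` because it divides `k`, so it divides `n`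
-- and must be 1.
coprime-* : ∀ {k m n} → Coprime k m → Coprime k n → Coprime k (m ℕ.* n)
coprime-* k⊥m k⊥n (d∣k , d∣mn) = k⊥n (d∣k , coprime-divisor
  (λ (e∣d , e∣m) → k⊥m (ℕ.∣-trans e∣d d∣k , e∣m)) d∣mn)

-- The gcd is a nonzero multiple of `p`, hence exceeds 1; were it all of `p * q`, then `q` would
-- divide `k`.
properGcd : ∀ {p q k} → Prime p → Prime q → p ∣ k → ¬ q ∣ k →
            1 ℕ.< ℕ.gcd k (p ℕ.* q) × ℕ.gcd k (p ℕ.* q) ℕ.< p ℕ.* q
properGcd {p} {q} {k} pp pq p∣k q∤k =
  ℕ.<-≤-trans (ℕ.nonTrivial⇒n>1 p) (ℕ.∣⇒≤ (ℕ.gcd-greatest p∣k (ℕ.m∣m*n q))) ,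
  ℕ.≤∧≢⇒< (ℕ.gcd[m,n]≤n k (p ℕ.* q)) λ g≡pq →
    q∤k (ℕ.∣-trans (ℕ.n∣m*n p) (subst (_∣ k) g≡pq (ℕ.gcd[m,n]∣m k (p ℕ.* q))))
  where
  instance
    _ = prime⇒nonTrivial pp
    _ = prime⇒nonZero pp
    _ = prime⇒nonZero pq
    pq≢0 : NonZero (p ℕ.* q)
    pq≢0 = ℕ.m*n≢0 p q
    g≢0 : NonZero (ℕ.gcd k (p ℕ.* q))
    g≢0 = ℕ.≢-nonZero (ℕ.gcd[m,n]≢0 k (p ℕ.* q) (inj₂ (ℕ.≢-nonZero⁻¹ (p ℕ.* q))))

suitable-≐ : ∀ {p q} → Prime p → Prime q → p ≢ q → ∀ f →
             Suitable (p ℕ.* q) f ≐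
             (IsRootMod p f ∩ ∁ (IsRootMod q f)) ∪ (∁ (IsRootMod p f) ∩ IsRootMod q f)
suitable-≐ {p} {q} pp pq p≢q f = (λ {x} → to {x}) , λ {x} → from {x}
  where
  ExactlyOne = (IsRootMod p f ∩ ∁ (IsRootMod q f)) ∪ (∁ (IsRootMod p f) ∩ IsRootMod q f)

  to : ∀ {x} → Suitable (p ℕ.* q) f x → ExactlyOne x
  to {x} (1<g , g<pq) with isRootMod? p f x | isRootMod? q f x
  -- Here `p * q` divides the gcd, which therefore cannot be smaller.
  ... | yes p∣k | yes q∣k = contradiction (ℤ.drop‿+<+ g<pq) (ℕ.≤⇒≯ (ℕ.∣⇒≤ ⦃ g≢0 ⦄
          (ℕ.gcd-greatest (coprime-*-∣ (distinctPrimes⇒coprime pp pq p≢q) p∣k q∣k) ℕ.∣-refl)))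
    where g≢0 = ℕ.>-nonZero (ℕ.<-trans ℕ.z<s (ℤ.drop‿+<+ 1<g))
  ... | yes p∣k | no q∤k  = inj₁ (p∣k , q∤k)
  ... | no p∤k  | yes q∣k = inj₂ (p∤k , q∣k)
  -- Here the value is coprime to `p * q`, so the gcd is 1.
  ... | no p∤k  | no q∤k  = contradiction (ℤ.drop‿+<+ 1<g) (ℕ.<-irrefl (sym (coprime⇒gcd≡1
          (coprime-* (prime∤⇒coprime pp p∤k) (prime∤⇒coprime pq q∤k)))))

  from : ∀ {x} → ExactlyOne x → Suitable (p ℕ.* q) f x
  from {x} (inj₁ (p∣k , q∤k)) with 1<g , g<pq ← properGcd {k = ∣ eval f (+ x) ∣} pp pq p∣k q∤k =
    +<+ 1<g , +<+ g<pq
  -- With the primes swapped, `properGcd` speaks of `q * p`, hence the rewrite.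
  from {x} (inj₂ (p∤k , q∣k)) with 1<g , g<pq ← properGcd {k = ∣ eval f (+ x) ∣} pq pp q∣k p∤k
    rewrite ℕ.*-comm q p = +<+ 1<g , +<+ g<pq

-- The formula for ν at a product of two primes

ν-semiprime : ∀ {p q} → Prime p → Prime q → p ≢ q → ∀ f →
              + ν (p ℕ.* q) f ≡ + #zerosMod q f * + p + + #zerosMod p f * + q
                                - + 2 * + #zerosMod p f * + #zerosMod q f
ν-semiprime {p} {q} pp pq p≢q f = begin
  + ν (p ℕ.* q) f
    ≡⟨ cong (+_ ∘ length) (filter-≐ (suitable? (p ℕ.* q) f) ((P? ∩? ∁? Q?) ∪? (∁? P? ∩? Q?))
         (suitable-≐ pp pq p≢q f) (upTo (p ℕ.* q))) ⟩
  + count ((P? ∩? ∁? Q?) ∪? (∁? P? ∩? Q?)) (p ℕ.* q)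
    ≡⟨ cong +_ (length-filter-∪ (P? ∩? ∁? Q?) (∁? P? ∩? Q?) (λ (px , _) (¬px , _) → ¬px px)
         (upTo (p ℕ.* q))) ⟩
  + (count (P? ∩? ∁? Q?) (p ℕ.* q) ℕ.+ count (∁? P? ∩? Q?) (p ℕ.* q))
    ≡⟨ cong +_ (cong₂ ℕ._+_
         (count-∩ p⊥q P? (∁? Q?) P-resp (∁-respects Q-resp))
         (count-∩ p⊥q (∁? P?) Q? (∁-respects P-resp) Q-resp)) ⟩
  + (n ℕ.* m′ ℕ.+ n′ ℕ.* m)
    ≡⟨ cong₂ _+_ (ℤ.pos-* n m′) (ℤ.pos-* n′ m) ⟩
  + n * + m′ + + n′ * + m
    -- The complementary counts are regrouped into the sums `n + n′` and `m + m′`, which are `p` and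
    -- `q`.
    ≡⟨ lemma (+ n) (+ n′) (+ m) (+ m′) ⟩
  + m * (+ n + + n′) + + n * (+ m + + m′) - + 2 * + n * + m
    ≡⟨ cong₂ (λ s t → + m * + s + + n * + t - + 2 * + n * + m) (count-∁ P? p) (count-∁ Q? q) ⟩
  + m * + p + + n * + q - + 2 * + n * + m
    ∎
  where
  open ≡-Reasoning
  instance
    _ = prime⇒nonZero pp
    _ = prime⇒nonZero pq
  p⊥q = distinctPrimes⇒coprime pp pq p≢q
  P? = isRootMod? p f
  Q? = isRootMod? q f
  P-resp = λ {x} {y} → isRootMod-respects p f {x} {y}
  Q-resp = λ {x} {y} → isRootMod-respects q f {x} {y}
  n  = count P? p
  n′ = count (∁? P?) p
  m  = count Q? q
  m′ = count (∁? Q?) q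
  lemma : ∀ n n′ m m′ → n * m′ + n′ * m ≡ m * (n + n′) + n * (m + m′) - + 2 * n * m
  lemma = solve-∀

-- The upper bound in terms of the degree

monotone-bound : ∀ {n m d p q} → n ℕ.≤ d → m ℕ.≤ d → 2 ℕ.* d ℕ.≤ p → 2 ℕ.* d ℕ.≤ q →
                 + m * + p + + n * + q - + 2 * + n * + m ≤ + d * + p + + d * + q - + 2 * + d * + d
monotone-bound {n} {m} {d} {p} {q} n≤d m≤d 2d≤p 2d≤q =
  subst (low ≤_) (trans (cong (_+_ low) excess≡) (sym (lemma (+ n) (+ m) (+ d) (+ p) (+ q))))
    (ℤ.i≤i+j low (+ excess))
  where
  a = d ℕ.∸ n
  b = d ℕ.∸ m
  low = + m * + p + + n * + q - + 2 * + n * + m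
  -- The gap between the two sides, built as a natural number so that it is nonnegative by
  -- construction. The hypotheses make each truncated subtraction exact, which `excess≡` relies on.
  excess = b ℕ.* (p ℕ.∸ 2 ℕ.* d) ℕ.+ a ℕ.* (q ℕ.∸ 2 ℕ.* d) ℕ.+ 2 ℕ.* (a ℕ.* b)

  difference : ∀ {x y} → x ℕ.≤ y → + (y ℕ.∸ x) ≡ + y - + x
  difference {x} {y} x≤y = trans (sym (ℤ.⊖-≥ x≤y)) (sym (ℤ.m-n≡m⊖n y x))

  difference₂ : ∀ {y} → 2 ℕ.* d ℕ.≤ y → + (y ℕ.∸ 2 ℕ.* d) ≡ + y - + 2 * + d
  difference₂ {y} 2d≤y = trans (difference 2d≤y) (cong (λ t → + y - t) (ℤ.pos-* 2 d))

  product : ∀ {x y i j} → + x ≡ i → + y ≡ j → + (x ℕ.* y) ≡ i * j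
  product {x} {y} x≡i y≡j = trans (ℤ.pos-* x y) (cong₂ _*_ x≡i y≡j)

  excess≡ : + excess ≡ (+ d - + m) * (+ p - + 2 * + d) + (+ d - + n) * (+ q - + 2 * + d)
                       + + 2 * ((+ d - + n) * (+ d - + m))
  excess≡ = cong₂ _+_
    (cong₂ _+_ (product (difference m≤d) (difference₂ 2d≤p)) (product (difference n≤d) (difference₂ 2d≤q)))
    (product {2} refl (product (difference n≤d) (difference m≤d)))

  lemma : ∀ n m d p q →
    d * p + d * q - + 2 * d * d ≡
    m * p + n * q - + 2 * n * m +
    ((d - m) * (p - + 2 * d) + (d - n) * (q - + 2 * d) + + 2 * ((d - n) * (d - m)))
  lemma = solve-∀

theorem2p8 :
    (N p q : ℕ) → Prime p → Prime q → p ℕ.< q → N ≡ p ℕ.* q →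
    (f : ℤ[X]) →
    let d = deg f
        n = #zerosMod p f
        m = #zerosMod q f
    in
    (+ ν N f ≡ + m * + p + + n * + q - + 2 * + n * + m)
    ×
    (¬ ZeroMod p f → ¬ ZeroMod q f → 2 ℕ.* d ℕ.< p →
      + ν N f ≤ + d * + p + + d * + q - + 2 * + d * + d)
theorem2p8 _ p q pp pq p<q refl f = ν≡ , λ f≢0[p] f≢0[q] 2d<p →
  ℤ.≤-trans (ℤ.≤-reflexive ν≡) (monotone-bound
    (#zerosMod≤deg pp f f≢0[p]) (#zerosMod≤deg pq f f≢0[q])
    (ℕ.<⇒≤ 2d<p) (ℕ.<⇒≤ (ℕ.<-trans 2d<p p<q)))
  where ν≡ = ν-semiprime pp pq (ℕ.<⇒≢ p<q) f
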